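{- For every integer $k\geq 1$, let $Q(2k)$ be the number of quasipolarities of $\mathbb{Z}/2k\mathbb{Z}$, and let $\sigma^{*}_{1}(k):=\sum_{d\,||\,k}d$ be the sum of the unitary (positive) divisors of $k$. Then \[ Q(2k)=\sigma^{*}_{1}(k). \]
   Context: For $n\geq 1$, an element $(u,v)$ of the semidirect product $(\mathbb{Z}/n\mathbb{Z})\rtimes(\mathbb{Z}/n\mathbb{Z})^{\times}$ is denoted $e^{u}.v$ and acts on $\mathbb{Z}/n\mathbb{Z}$ as the affine bijection $e^{u}.v(x)=vx+u$. Such an $e^{u}.v$ is called a quasipolarity of $\mathbb{Z}/n\mathbb{Z}$ if, as a map on $\mathbb{Z}/n\mathbb{Z}$, it satisfies $(e^{u}.v)\circ(e^{u}.v)=\mathrm{Id}$ and has no fixed points. A positive divisor $d$ of $n$ is called unitary, written $d\,||\,n$, if $\gcd(d,n/d)=1$. -}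

module Defs where

open import Algebra.Definitions using (Invertible)
open import Data.Fin.Base using (Fin; toℕ)
open import Data.Fin.Properties using (_≟_; any?; all?)
open import Data.List.Base using (List; length; filter; allFin; upTo; cartesianProduct)
open import Data.Nat.Base as ℕ using (ℕ; zero; suc; NonZero)
open import Data.Nat.Divisibility using (_∣_; _∣?_)
open import Data.Nat.DivMod using (_mod_; _/_)
open import Data.Nat.GCD using (gcd)
open import Data.Nat.ListAction using (sum)
import Data.Nat.Properties as ℕ
open import Data.Product.Base using (_×_; _,_; uncurry)
open import Function.Base using (_∘_; id)
open import Relation.Binary.PropositionalEquality using (_≡_; _≢_; _≗_)
open import Relation.Nullary.Decidable using (Dec; no; map′; _×-dec_; ¬?)

-- ℤ/nℤ is represented by the canonical residues 0, …, n-1.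
ℤ/_ : ℕ → Set
ℤ/ n = Fin n

module _ {n : ℕ} .{{_ : NonZero n}} where

  infixl 6 _+_
  infixl 7 _*_

  _+_ : ℤ/ n → ℤ/ n → ℤ/ n
  x + y = (toℕ x ℕ.+ toℕ y) mod n

  _*_ : ℤ/ n → ℤ/ n → ℤ/ n
  x * y = (toℕ x ℕ.* toℕ y) mod n

  1# : ℤ/ n
  1# = 1 mod n

  IsUnit : ℤ/ n → Set
  IsUnit = Invertible _≡_ 1# _*_

  isUnit? : (v : ℤ/ n) → Dec (IsUnit v)
  isUnit? v = any? λ w → (w * v ≟ 1#) ×-dec (v * w ≟ 1#)

  e^_∙_ : ℤ/ n → ℤ/ n → (ℤ/ n → ℤ/ n)
  (e^ u ∙ v) x = v * x + u

  IsQuasipolarity : ℤ/ n × ℤ/ n → Set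
  IsQuasipolarity (u , v) =
    ((e^ u ∙ v) ∘ (e^ u ∙ v) ≗ id) × (∀ x → (e^ u ∙ v) x ≢ x)

  isQuasipolarity? : (g : ℤ/ n × ℤ/ n) → Dec (IsQuasipolarity g)
  isQuasipolarity? (u , v) =
    all? (λ x → (e^ u ∙ v) ((e^ u ∙ v) x) ≟ x) ×-dec
    all? (λ x → ¬? ((e^ u ∙ v) x ≟ x))

module _ (n : ℕ) .{{_ : NonZero n}} where

  units : List (ℤ/ n)
  units = filter isUnit? (allFin n)

  -- The underlying set of (ℤ/nℤ) ⋊ (ℤ/nℤ)ˣ, each element listed once.
  affineElements : List (ℤ/ n × ℤ/ n)
  affineElements = cartesianProduct (allFin n) units

  Q : ℕ
  Q = length (filter isQuasipolarity? affineElements)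

infix 4 _∥_ _∥?_

record _∥_ (d n : ℕ) : Set where
  constructor unitary
  field
    {{d≢0}}  : NonZero d
    divides  : d ∣ n
    coprime  : gcd d (n / d) ≡ 1

_∥?_ : (d n : ℕ) → Dec (d ∥ n)
zero  ∥? n = no λ { (unitary {{()}} _ _) }
suc d ∥? n =
  map′ (uncurry unitary) (λ { (unitary p q) → p , q })
       ((suc d ∣? n) ×-dec (gcd (suc d) (n / suc d) ℕ.≟ 1))

-- A divisor of n ≥ 1 is at most n, so the range 0, …, n misses none.
σ₁* : (n : ℕ) .{{_ : NonZero n}} → ℕ
σ₁* n = sum (filter (_∥? n) (upTo (suc n)))

{-# OPTIONS --safe #-}

-- Write an involution e^u.v of ℤ/2k with v = 1 + 2w, and put a = gcd(w, k) and
-- b = gcd(w + 1, k); these are coprime divisors of k. The involution condition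
-- says k ∣ 2w(w+1) and k ∣ (w+1)u, and e^u.v has a fixed point iff 2a ∣ u. The
-- first condition leaves k = ab or k = 2ab; the latter forces 2a ∣ u by the second
-- condition. So in a quasipolarity k = ab and u = a(1 + 2j) with j < b.
-- Conversely, for every unitary divisor b of k, with a = k / b, exactly one w < k
-- satisfies a ∣ w and b ∣ w + 1, and each j < b gives a quasipolarity. Hence the
-- quasipolarities correspond to the pairs (b, j) with b ∥ k and j < b.
module Submission where

open import Defs hiding (_+_; _*_)
open import Data.Nat.Base using (ℕ; NonZero) renaming (_*_ to _*ℕ_)
open import Data.Nat.Properties using (m*n≢0)
open import Relation.Binary.PropositionalEquality using (_≡_)

open import Data.Fin.Base as Fin using (Fin; toℕ; fromℕ<)
open import Data.Fin.Properties
  using (injective⇒≤; toℕ-fromℕ<; toℕ-injective; toℕ<n)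
open import Data.List.Base
  using (List; []; _∷_; _++_; map; length; lookup; filter; upTo)
open import Data.List.Membership.Propositional using (_∈_)
open import Data.List.Membership.Propositional.Properties
open import Data.List.Properties using (length-++; length-map; length-upTo)
import Data.List.Relation.Unary.All as All
open import Data.List.Relation.Unary.AllPairs using ([]; _∷_)
open import Data.List.Relation.Unary.Any as Any using (here; there)
open import Data.List.Relation.Unary.Any.Properties using (lookup-index)
open import Data.List.Relation.Unary.Unique.Propositional using (Unique)
import Data.List.Relation.Unary.Unique.Propositional.Properties as Unique
open import Data.Nat.Base as ℕ using (zero; suc; _≤_; _<_; _∸_; _+_; _*_)
open import Data.Nat.Coprimality as Coprime using (Coprime; coprime-divisor; coprime⇒gcd≡1)
open import Data.Nat.Divisibility
open import Data.Nat.DivMod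
open import Data.Nat.GCD
open import Data.Nat.ListAction using (sum)
import Data.Nat.Properties as ℕ
open import Data.Nat.Tactic.RingSolver using (solve-∀)
open import Data.Product.Base using (∃; _×_; _,_; proj₁; proj₂)
open import Data.Product.Properties using (,-injectiveʳ)
open import Data.Sum.Base using (inj₁; inj₂)
open import Function.Base using (_∘_; case_of_)
open import Level using (Level)
open import Relation.Binary.Core using (REL)
open import Relation.Binary.PropositionalEquality
  using (refl; sym; trans; cong; cong₂; subst; subst₂; module ≡-Reasoning)
open import Relation.Nullary using (¬_; contradiction)

private variable
  ℓ₁ ℓ₂ ℓ₃ : Level

-- Lists

module _ {A : Set ℓ₁} where

  lookup-injective : {xs : List A} → Unique xs → ∀ {i j} →
                     lookup xs i ≡ lookup xs j → i ≡ j
  lookup-injective (_    ∷ _)  {Fin.zero}  {Fin.zero}  _  = refl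
  lookup-injective (x∉xs ∷ _)  {Fin.zero}  {Fin.suc j} eq =
    contradiction eq (All.lookup x∉xs (∈-lookup j))
  lookup-injective (x∉xs ∷ _)  {Fin.suc i} {Fin.zero}  eq =
    contradiction (sym eq) (All.lookup x∉xs (∈-lookup i))
  lookup-injective (_    ∷ xs!) {Fin.suc i} {Fin.suc j} eq =
    cong Fin.suc (lookup-injective xs! eq)

module _ {A : Set ℓ₁} {B : Set ℓ₂} (R : REL A B ℓ₃) where

  -- Pigeonhole: each position of `xs` picks a position of `ys` holding a related element, and
  -- `injective` makes this choice injective. A relation instead of a function lets one relation
  -- serve both inequalities of the count.
  length-≤ : {xs : List A} {ys : List B} → Unique xs →
             (∀ {x} → x ∈ xs → ∃ λ y → y ∈ ys × R x y) →
             (∀ {x x′ y} → R x y → R x′ y → x ≡ x′) →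
             length xs ≤ length ys
  length-≤ {xs} {ys} xs! total injective = injective⇒≤ {f = position} λ {i} {j} eq →
    lookup-injective xs!
      (injective (related i) (subst (R (lookup xs j)) (image-≡ i j eq) (related j)))
    where
    image : ∀ i → ∃ λ y → y ∈ ys × R (lookup xs i) y
    image i = total (∈-lookup i)

    position : Fin (length xs) → Fin (length ys)
    position i = Any.index (proj₁ (proj₂ (image i)))

    related : ∀ i → R (lookup xs i) (proj₁ (image i))
    related i = proj₂ (proj₂ (image i))

    image-≡ : ∀ i j → position i ≡ position j → proj₁ (image j) ≡ proj₁ (image i)
    image-≡ i j eq = trans (lookup-index (proj₁ (proj₂ (image j))))
      (trans (cong (lookup ys) (sym eq)) (sym (lookup-index (proj₁ (proj₂ (image i))))))

-- Turns a sum into a cardinality, so that the theorem compares the lengths of two duplicate-free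
-- lists.
below : List ℕ → List (ℕ × ℕ)
below []       = []
below (b ∷ bs) = map (b ,_) (upTo b) ++ below bs

length-below : ∀ bs → length (below bs) ≡ sum bs
length-below []       = refl
length-below (b ∷ bs) = trans (length-++ (map (b ,_) (upTo b)))
  (cong₂ _+_ (trans (length-map (b ,_) (upTo b)) (length-upTo b)) (length-below bs))

∈-below⁺ : ∀ {bs b j} → b ∈ bs → j < b → (b , j) ∈ below bs
∈-below⁺             (here refl)  j<b = ∈-++⁺ˡ (∈-map⁺ _ (∈-upTo⁺ j<b))
∈-below⁺ {bs = c ∷ _} (there b∈bs) j<b = ∈-++⁺ʳ (map (c ,_) (upTo c)) (∈-below⁺ b∈bs j<b)

∈-below⁻ : ∀ bs {b j} → (b , j) ∈ below bs → b ∈ bs × j < b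
∈-below⁻ (c ∷ bs) p with ∈-++⁻ (map (c ,_) (upTo c)) p
... | inj₁ q with _ , j∈ , refl ← ∈-map⁻ (c ,_) q = here refl , ∈-upTo⁻ j∈
... | inj₂ q with b∈bs , j<b ← ∈-below⁻ bs q = there b∈bs , j<b

below-! : ∀ {bs} → Unique bs → Unique (below bs)
below-! []                          = []
below-! {bs = b ∷ bs} (b∉bs ∷ bs!) =
  Unique.++⁺ (Unique.map⁺ ,-injectiveʳ (Unique.upTo⁺ b)) (below-! bs!) λ (p , q) →
    case ∈-map⁻ (b ,_) p of λ where
      (_ , _ , refl) → All.lookup b∉bs (proj₁ (∈-below⁻ bs q)) refl

-- Divisibility

odd : ∀ n → 2 ∤ n → ∃ λ h → n ≡ 1 + 2 * h
odd zero          2∤n = contradiction (2 ∣0) 2∤n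
odd (suc zero)    2∤n = 0 , refl
odd (suc (suc n)) 2∤n with h , refl ← odd n (2∤n ∘ ∣m∣n⇒∣m+n ∣-refl) =
  suc h , cong suc (sym (ℕ.*-suc 2 h))

2∤1+2n : ∀ n → 2 ∤ 1 + 2 * n
2∤1+2n n 2∣1+2n = contradiction
  (∣1⇒≡1 (∣m+n∣m⇒∣n (subst (2 ∣_) (ℕ.+-comm 1 (2 * n)) 2∣1+2n) (m∣m*n n))) λ ()

-- When `m` and `m + o` are divided by `n`, the equal remainders cancel and leave `o` as a
-- difference of two multiples of `n`.
[m+o]%n≡m%n⇒n∣o : ∀ m o n .{{_ : NonZero n}} → (m + o) % n ≡ m % n → n ∣ o
[m+o]%n≡m%n⇒n∣o m o n eq = ∣m+n∣m⇒∣n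
  (subst (n ∣_) (sym lemma) (n∣m*n ((m + o) / n))) (n∣m*n (m / n))
  where
  open ≡-Reasoning
  lemma : m / n * n + o ≡ (m + o) / n * n
  lemma = ℕ.+-cancelˡ-≡ (m % n) _ _ (begin
    m % n + (m / n * n + o)             ≡⟨ ℕ.+-assoc (m % n) _ o ⟨
    m % n + m / n * n + o               ≡⟨ cong (_+ o) (m≡m%n+[m/n]*n m n) ⟨
    m + o                               ≡⟨ m≡m%n+[m/n]*n (m + o) n ⟩
    (m + o) % n + (m + o) / n * n       ≡⟨ cong (_+ (m + o) / n * n) eq ⟩
    m % n + (m + o) / n * n             ∎)

coprime-∣⇒*∣ : ∀ {m n o} → Coprime m n → m ∣ o → n ∣ o → m * n ∣ o
coprime-∣⇒*∣ {m} {n} c (divides q refl) n∣qm =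
  subst (_∣ q * m) (ℕ.*-comm n m) (*-monoˡ-∣ m
    (coprime-divisor (Coprime.sym c) (subst (n ∣_) (ℕ.*-comm q m) n∣qm)))

-- A common divisor divides two consecutive numbers, hence 1. Applied to `w` and `suc w`, this
-- supplies the coprimality of the factors of `k`.
m∣n∧p∣1+n⇒coprime : ∀ {m n p} → m ∣ n → p ∣ suc n → Coprime m p
m∣n∧p∣1+n⇒coprime {n = n} m∣n p∣1+n {d} (d∣m , d∣p) = ∣1⇒≡1
  (∣m+n∣m⇒∣n (subst (d ∣_) (ℕ.+-comm 1 n) (∣-trans d∣p p∣1+n)) (∣-trans d∣m m∣n))

-- `k` divides both `n * m` and `n * k`, hence their gcd, which is `n * gcd m k`.
∣m*n⇒∣gcd*n : ∀ {k} m n → k ∣ m * n → k ∣ gcd m k * n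
∣m*n⇒∣gcd*n {k} m n k∣mn = subst (k ∣_)
  (trans (sym (c*gcd[m,n]≡gcd[cm,cn] n m k)) (ℕ.*-comm n (gcd m k)))
  (gcd-greatest (subst (k ∣_) (ℕ.*-comm m n) k∣mn) (n∣m*n n))

-- Bézout's identity multiplied by the cofactor `q` of `m`. It produces both the fixed points and
-- the Chinese remainder solutions below.
gcd∣⇒solvable : ∀ w k .{{_ : NonZero k}} {m} → gcd w k ∣ m → ∃ λ x → k ∣ w * x + m
gcd∣⇒solvable w k@(suc l) (divides q refl) with Bézout.identity (gcd-GCD w k)
-- Here `gcd w k + y * k ≡ x * w` has the wrong sign; the factor `l`, which is `k - 1`, stands in
-- for -1 modulo `k`.
... | Bézout.+- x y eq = l * (q * x) , divides (q * gcd w k + l * (q * y))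
  (trans (cong (_+ q * gcd w k) (trans (assoc w l q x) (cong (l * q *_) (sym eq))))
         (collect l q (gcd w k) y))
  where
  assoc : ∀ w l q x → w * (l * (q * x)) ≡ l * q * (x * w)
  assoc = solve-∀
  collect : ∀ l q g y → l * q * (g + y * suc l) + q * g ≡ (q * g + l * (q * y)) * suc l
  collect = solve-∀
... | Bézout.-+ x y eq = q * x , divides (q * y)
  (trans (factor w q x (gcd w k)) (trans (cong (q *_) eq) (sym (ℕ.*-assoc q y k))))
  where
  factor : ∀ w q x g → w * (q * x) + q * g ≡ q * (g + x * w)
  factor = solve-∀

-- Parametrisation of quasipolarities by pairs (b , j)

-- Stated for natural representatives `U` and `V`, which keeps the divisibility arithmetic free of
-- reduction modulo `2 * k`; the bounds below `2 * k` enter separately. The factors are coprime by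
-- `a∣w` and `b∣1+w`.
record Param (k U V b j : ℕ) : Set where
  constructor param
  field
    a w    : ℕ
    k≡a*b  : k ≡ a * b
    a∣w    : a ∣ w
    b∣1+w  : b ∣ suc w
    U≡     : U ≡ a * (1 + 2 * j)
    V≡     : V ≡ 1 + 2 * w

V<2k⇒w<k : ∀ {k w} → 1 + 2 * w < 2 * k → w < k
V<2k⇒w<k {k} {w} lt = ℕ.*-cancelˡ-< 2 w k (ℕ.<-trans (ℕ.n<1+n _) lt)

w<k⇒V<2k : ∀ {k w} → w < k → 1 + 2 * w < 2 * k
w<k⇒V<2k {k} {w} lt = subst (_≤ 2 * k) (ℕ.*-suc 2 w) (ℕ.*-monoʳ-≤ 2 lt)

-- Uniqueness in the Chinese remainder theorem: the difference is divisible by the coprime `a` and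
-- `b`, so if nonzero it is at least `a * b`, yet it is at most `w′`.
w-unique-≤ : ∀ {a b w w′} → a ∣ w → b ∣ suc w → a ∣ w′ → b ∣ suc w′ →
             w ≤ w′ → w′ < a * b → w ≡ w′
w-unique-≤ {a} {b} {w} {w′} a∣w b∣w a∣w′ b∣w′ w≤w′ w′<ab with w′ ∸ w in eq
... | zero  = ℕ.≤-antisym w≤w′ (ℕ.m∸n≡0⇒m≤n eq)
... | suc d = contradiction w′<ab (ℕ.≤⇒≯ (ℕ.≤-trans
  (∣⇒≤ (coprime-∣⇒*∣ (m∣n∧p∣1+n⇒coprime a∣w b∣w)
    (∣m+n∣m⇒∣n (subst (a ∣_) w′≡ a∣w′) a∣w)
    (∣m+n∣m⇒∣n (subst (b ∣_) (cong suc w′≡) b∣w′) b∣w)))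
  (subst (_≤ w′) eq (ℕ.m∸n≤m w′ w))))
  where
  w′≡ : w′ ≡ w + suc d
  w′≡ = trans (sym (ℕ.m+[n∸m]≡n w≤w′)) (cong (w +_) eq)

w-unique : ∀ {a b w w′} → a ∣ w → b ∣ suc w → a ∣ w′ → b ∣ suc w′ →
           w < a * b → w′ < a * b → w ≡ w′
w-unique {w = w} {w′} p q p′ q′ lt lt′ with ℕ.≤-total w w′
... | inj₁ w≤w′ = w-unique-≤ p q p′ q′ w≤w′ lt′
... | inj₂ w′≤w = sym (w-unique-≤ p′ q′ p q w′≤w lt)

-- `k` and `b` determine the cofactor `a`, hence `U`; then `w`, being below `k`, is determined by
-- its residues modulo `a` and `b`.
param-injective : ∀ {k U V U′ V′ b j} .{{_ : NonZero k}} → V < 2 * k → V′ < 2 * k →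
                  Param k U V b j → Param k U′ V′ b j → U ≡ U′ × V ≡ V′
param-injective {b = b} lt lt′
  (param a w refl a∣w b∣w refl refl) (param a′ w′ eq a∣w′ b∣w′ refl refl)
  with refl ← ℕ.*-cancelʳ-≡ a a′ b {{ℕ.m*n≢0⇒n≢0 a}} eq
  = refl , cong (λ w → 1 + 2 * w)
                (w-unique a∣w b∣w a∣w′ b∣w′ (V<2k⇒w<k lt) (V<2k⇒w<k lt′))

-- `V` determines `w`. Since both factorisations share `w`, `a` is coprime to `b′` and divides
-- `a′ * b′`, hence divides `a′`. By symmetry `a ≡ a′`, and cancellation gives `b` and `j`.
param-functional : ∀ {k U V b j b′ j′} .{{_ : NonZero k}} →
                   Param k U V b j → Param k U V b′ j′ → b ≡ b′ × j ≡ j′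
param-functional {b = b} {j} {b′} {j′}
  (param a w refl a∣w b∣w refl refl) (param a′ w′ ab≡a′b′ a∣w′ b∣w′ U≡ V≡)
  with refl ← ℕ.*-cancelˡ-≡ w w′ 2 (ℕ.suc-injective V≡)
  with refl ← ∣-antisym
    (coprime-divisor (m∣n∧p∣1+n⇒coprime a∣w b∣w′)
      (subst (a ∣_) (trans ab≡a′b′ (ℕ.*-comm a′ b′)) (m∣m*n b)))
    (coprime-divisor (m∣n∧p∣1+n⇒coprime a∣w′ b∣w)
      (subst (a′ ∣_) (trans (sym ab≡a′b′) (ℕ.*-comm a b)) (m∣m*n b′)))
  = ℕ.*-cancelˡ-≡ b b′ a {{a≢0}} ab≡a′b′
  , ℕ.*-cancelˡ-≡ j j′ 2 (ℕ.suc-injective (ℕ.*-cancelˡ-≡ _ _ a {{a≢0}} U≡))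
  where
  a≢0 : NonZero a
  a≢0 = ℕ.m*n≢0⇒m≢0 a

param-∥ : ∀ {k U V b j} .{{_ : NonZero k}} → Param k U V b j → b ∥ k
param-∥ {b = b} (param a w refl a∣w b∣w _ _) = unitary {{b≢0}} (n∣m*n a)
  (subst (λ c → gcd b c ≡ 1) (sym (m*n/n≡m a b {{b≢0}}))
    (coprime⇒gcd≡1 (Coprime.sym (m∣n∧p∣1+n⇒coprime a∣w b∣w))))
  where
  b≢0 : NonZero b
  b≢0 = ℕ.m*n≢0⇒n≢0 a

U<2k⇒j<b : ∀ {a b j} → a * (1 + 2 * j) < 2 * (a * b) → j < b
U<2k⇒j<b {a} {b} {j} lt = V<2k⇒w<k
  (ℕ.*-cancelˡ-< a (1 + 2 * j) (2 * b) (subst (a * (1 + 2 * j) <_) (swap a b) lt))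
  where
  swap : ∀ a b → 2 * (a * b) ≡ a * (2 * b)
  swap = solve-∀

j<b⇒U<2k : ∀ {a b j} .{{_ : NonZero a}} → j < b → a * (1 + 2 * j) < 2 * (a * b)
j<b⇒U<2k {a} {b} {j} lt = subst (a * (1 + 2 * j) <_) (swap a b)
  (ℕ.*-monoʳ-< a (w<k⇒V<2k lt))
  where
  swap : ∀ a b → a * (2 * b) ≡ 2 * (a * b)
  swap = solve-∀

-- Existence in the Chinese remainder theorem: `a` and `b` are coprime, so some `x` has
-- `b ∣ a * x + 1`. Reducing `a * x` modulo `k` ensures `V < 2 * k` and, as `a` and `b` divide `k`,
-- keeps both residues.
param-exists : ∀ {k b j} .{{_ : NonZero k}} → b ∥ k → j < b →
               ∃ λ U → ∃ λ V → U < 2 * k × V < 2 * k × Param k U V b j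
param-exists {k} {b} {j} (unitary b∣k gcd≡1) j<b =
  a * (1 + 2 * j) , 1 + 2 * w ,
  subst (λ k → a * (1 + 2 * j) < 2 * k) (sym k≡ab) (j<b⇒U<2k {{a≢0}} j<b) ,
  w<k⇒V<2k (m%n<n (a * x) k) ,
  param a w k≡ab (%-presˡ-∣ (m∣m*n x) (subst (a ∣_) (sym k≡ab) (m∣m*n b)))
    (m%n≡0⇒n∣m (suc w) b b∣1+w) refl refl
  where
  a : ℕ
  a = k / b

  k≡ab : k ≡ a * b
  k≡ab = sym (m/n*n≡m b∣k)

  a≢0 : NonZero a
  a≢0 = ℕ.m*n≢0⇒m≢0 a {{subst NonZero k≡ab (ℕ.≢-nonZero (ℕ.≢-nonZero⁻¹ k))}}

  solution : ∃ λ x → b ∣ a * x + 1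
  solution = gcd∣⇒solvable a b (subst (_∣ 1) (trans (sym gcd≡1) (gcd-comm b a)) ∣-refl)

  x w : ℕ
  x = proj₁ solution
  w = (a * x) % k

  b∣1+w : suc w % b ≡ 0
  b∣1+w = begin
    (1 + w) % b               ≡⟨ %-distribˡ-+ 1 w b ⟩
    (1 % b + w % b) % b       ≡⟨ cong (λ c → (1 % b + c) % b) (m∣n⇒o%n%m≡o%m b k (a * x) b∣k) ⟩
    (1 % b + a * x % b) % b   ≡⟨ %-distribˡ-+ 1 (a * x) b ⟨
    (1 + a * x) % b           ≡⟨ cong (_% b) (ℕ.+-comm 1 (a * x)) ⟩
    (a * x + 1) % b           ≡⟨ n∣m⇒m%n≡0 _ b (proj₂ solution) ⟩
    0                         ∎
    where open ≡-Reasoning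

decompose : ∀ {k U w} .{{_ : NonZero k}} → k ∣ 2 * (w * suc w) → k ∣ suc w * U →
            2 * gcd w k ∤ U → ∃ λ b → ∃ λ j → Param k U (1 + 2 * w) b j
decompose {k} {U} {w} k∣2w[1+w] k∣[1+w]U 2a∤U = b , split a*b∣k
  where
  a b : ℕ
  a = gcd w k
  b = gcd (suc w) k

  a*b∣k : a * b ∣ k
  a*b∣k = coprime-∣⇒*∣ (m∣n∧p∣1+n⇒coprime (gcd[m,n]∣m w k) (gcd[m,n]∣m (suc w) k))
    (gcd[m,n]∣n w k) (gcd[m,n]∣n (suc w) k)

  -- First `w` and then `suc w` is replaced by its gcd with `k`.
  k∣2ab : k ∣ 2 * (a * b)
  k∣2ab = subst (k ∣_) (eq₃ a b) (∣m*n⇒∣gcd*n (suc w) (2 * a) (subst (k ∣_) (eq₂ a w)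
    (∣m*n⇒∣gcd*n w (2 * suc w) (subst (k ∣_) (eq₁ w) k∣2w[1+w]))))
    where
    eq₁ : ∀ w → 2 * (w * suc w) ≡ w * (2 * suc w)
    eq₁ = solve-∀
    eq₂ : ∀ a w → a * (2 * suc w) ≡ suc w * (2 * a)
    eq₂ = solve-∀
    eq₃ : ∀ a b → b * (2 * a) ≡ 2 * (a * b)
    eq₃ = solve-∀

  k∣bU : k ∣ b * U
  k∣bU = ∣m*n⇒∣gcd*n (suc w) U k∣[1+w]U

  split : a * b ∣ k → ∃ λ j → Param k U (1 + 2 * w) b j
  split (divides c k≡) = cases c k≡
    where
    c*a*b≢0 : NonZero (c * (a * b))
    c*a*b≢0 = subst NonZero k≡ (ℕ.≢-nonZero (ℕ.≢-nonZero⁻¹ k))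

    a*b≢0 : NonZero (a * b)
    a*b≢0 = ℕ.m*n≢0⇒n≢0 c {{c*a*b≢0}}

    b≢0 : NonZero b
    b≢0 = ℕ.m*n≢0⇒n≢0 a {{a*b≢0}}

    -- Used with `m` equal to `a` when `k ≡ a * b`, and to `2 * a` when `k ≡ 2 * (a * b)`.
    cancel-b : ∀ {m} → k ≡ b * m → m ∣ U
    cancel-b k≡bm = *-cancelˡ-∣ b {{b≢0}} (subst (_∣ b * U) k≡bm k∣bU)

    odd-multiple : a ∣ U → ∃ λ j → U ≡ a * (1 + 2 * j)
    odd-multiple (divides t refl)
      -- An even cofactor `t` would make `2 * a` divide `U`.
      with j , refl ← odd t (2a∤U ∘ *-monoˡ-∣ a) = j , ℕ.*-comm (1 + 2 * j) a

    cases : ∀ c → k ≡ c * (a * b) → ∃ λ j → Param k U (1 + 2 * w) b j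
    cases 0 eq = contradiction eq (ℕ.≢-nonZero⁻¹ k)
    cases 1 eq = j , param a w k≡ab (gcd[m,n]∣m w k) (gcd[m,n]∣m (suc w) k) U≡ refl
      where
      k≡ab : k ≡ a * b
      k≡ab = trans eq (ℕ.*-identityˡ (a * b))
      multiple : ∃ λ j → U ≡ a * (1 + 2 * j)
      multiple = odd-multiple (cancel-b (trans k≡ab (ℕ.*-comm a b)))
      j : ℕ
      j = proj₁ multiple
      U≡ : U ≡ a * (1 + 2 * j)
      U≡ = proj₂ multiple
    cases 2 eq = contradiction (cancel-b (trans eq (swap a b))) 2a∤U
      where
      swap : ∀ a b → 2 * (a * b) ≡ b * (2 * a)
      swap = solve-∀
    -- `c * (a * b)` divides `2 * (a * b)`, so `c` would divide 2.
    cases c@(suc (suc (suc _))) eq = contradiction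
      (*-cancelʳ-∣ {m = c} (a * b) {{a*b≢0}} (subst (_∣ 2 * (a * b)) eq k∣2ab))
      (>⇒∤ (ℕ.s≤s (ℕ.s≤s (ℕ.s≤s ℕ.z≤n))))

-- Affine maps on residues

[m%n+o]%n≡[m+o]%n : ∀ m o n .{{_ : NonZero n}} → (m % n + o) % n ≡ (m + o) % n
[m%n+o]%n≡[m+o]%n m o n = begin
  (m % n + o) % n           ≡⟨ %-distribˡ-+ (m % n) o n ⟩
  (m % n % n + o % n) % n   ≡⟨ cong (λ r → (r + o % n) % n) (m%n%n≡m%n m n) ⟩
  (m % n + o % n) % n       ≡⟨ %-distribˡ-+ m o n ⟨
  (m + o) % n               ∎
  where open ≡-Reasoning

[m*[o%n]]%n≡[m*o]%n : ∀ m o n .{{_ : NonZero n}} → (m * (o % n)) % n ≡ (m * o) % n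
[m*[o%n]]%n≡[m*o]%n m o n = begin
  (m * (o % n)) % n             ≡⟨ %-distribˡ-* m (o % n) n ⟩
  ((m % n) * (o % n % n)) % n   ≡⟨ cong (λ r → ((m % n) * r) % n) (m%n%n≡m%n o n) ⟩
  ((m % n) * (o % n)) % n       ≡⟨ %-distribˡ-* m o n ⟨
  (m * o) % n                   ∎
  where open ≡-Reasoning

[m*[o%n]+p]%n≡[m*o+p]%n : ∀ m o p n .{{_ : NonZero n}} →
                          (m * (o % n) + p) % n ≡ (m * o + p) % n
[m*[o%n]+p]%n≡[m*o+p]%n m o p n = begin
  (m * (o % n) + p) % n         ≡⟨ [m%n+o]%n≡[m+o]%n (m * (o % n)) p n ⟨
  ((m * (o % n)) % n + p) % n   ≡⟨ cong (λ r → (r + p) % n) ([m*[o%n]]%n≡[m*o]%n m o n) ⟩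
  ((m * o) % n + p) % n         ≡⟨ [m%n+o]%n≡[m+o]%n (m * o) p n ⟩
  (m * o + p) % n               ∎
  where open ≡-Reasoning

module _ {n : ℕ} .{{_ : NonZero n}} where

  toℕ-mod : ∀ m → toℕ (m mod n) ≡ m % n
  toℕ-mod m = toℕ-fromℕ< (m%n<n m n)

  toℕ-affine : ∀ (u v x : ℤ/ n) → toℕ ((e^ u ∙ v) x) ≡ (toℕ v * toℕ x + toℕ u) % n
  toℕ-affine u v x = trans (toℕ-mod _)
    (trans (cong (λ r → (r + toℕ u) % n) (toℕ-mod (toℕ v * toℕ x)))
           ([m%n+o]%n≡[m+o]%n (toℕ v * toℕ x) (toℕ u) n))

  -- The inner reduction is absorbed by the outer one, so the composite is a polynomial expression
  -- reduced once.
  toℕ-affine² : ∀ (u v x : ℤ/ n) → toℕ ((e^ u ∙ v) ((e^ u ∙ v) x)) ≡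
                (toℕ v * (toℕ v * toℕ x + toℕ u) + toℕ u) % n
  toℕ-affine² u v x = trans (toℕ-affine u v _)
    (trans (cong (λ y → (toℕ v * y + toℕ u) % n) (toℕ-affine u v x))
           ([m*[o%n]+p]%n≡[m*o+p]%n (toℕ v) (toℕ v * toℕ x + toℕ u) (toℕ u) n))

-- Isolates the displacement of `x`: a fixed point is an `x` for which the modulus divides
-- `2 * (w * x) + u`.
affine-odd : ∀ w x u → (1 + 2 * w) * x + u ≡ x + (2 * (w * x) + u)
affine-odd = solve-∀

-- Turns `V * V ≡ 1` modulo `2 * k` into `k ∣ 2 * (w * suc w)`.
square-odd : ∀ w → (1 + 2 * w) * (1 + 2 * w) ≡ 1 + 2 * (2 * (w * suc w))
square-odd = solve-∀

-- Quasipolarities of ℤ/2k and their parameters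

module _ {k : ℕ} .{{k≢0 : NonZero k}} where

  private
    n : ℕ
    n = 2 * k

    instance
      n≢0 : NonZero n
      n≢0 = m*n≢0 2 k

    1<n : 1 < n
    1<n = ℕ.*-monoʳ-≤ 2 (ℕ.>-nonZero⁻¹ k)

  -- The involution evaluated at 0 and 1 yields the two divisibilities, and the absence of fixed
  -- points yields `2 * gcd w k ∤ U`; these are the hypotheses of `decompose`.
  quasipolarity⇒param : ∀ {u v : ℤ/ n} → IsQuasipolarity (u , v) →
                        ∃ λ b → ∃ λ j → Param k (toℕ u) (toℕ v) b j
  quasipolarity⇒param {u} {v} (involutive , fixed-point-free) = parametrised
    where
    U V : ℕ
    U = toℕ u
    V = toℕ v

    involutive-ℕ : ∀ {X} → X < n → (V * (V * X + U) + U) % n ≡ X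
    involutive-ℕ {X} X<n = begin
      (V * (V * X + U) + U) % n
        ≡⟨ cong (λ X → (V * (V * X + U) + U) % n) (toℕ-fromℕ< X<n) ⟨
      (V * (V * toℕ (fromℕ< X<n) + U) + U) % n
        ≡⟨ toℕ-affine² u v (fromℕ< X<n) ⟨
      toℕ ((e^ u ∙ v) ((e^ u ∙ v) (fromℕ< X<n)))
        ≡⟨ cong toℕ (involutive (fromℕ< X<n)) ⟩
      toℕ (fromℕ< X<n)
        ≡⟨ toℕ-fromℕ< X<n ⟩
      X ∎
      where open ≡-Reasoning

    n∣[1+V]U : n ∣ suc V * U
    n∣[1+V]U = subst (n ∣_) (at-0 V U)
      (m%n≡0⇒n∣m _ n (involutive-ℕ (ℕ.<-trans ℕ.z<s 1<n)))
      where
      at-0 : ∀ V U → V * (V * 0 + U) + U ≡ suc V * U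
      at-0 = solve-∀

    -- At 1 the value is `V * V + suc V * U`, whose second term is a multiple of `n` by the
    -- evaluation at 0.
    V²%n≡1 : (V * V) % n ≡ 1
    V²%n≡1 = begin
      (V * V) % n                 ≡⟨ %-remove-+ʳ (V * V) n∣[1+V]U ⟨
      (V * V + suc V * U) % n     ≡⟨ cong (_% n) (at-1 V U) ⟨
      (V * (V * 1 + U) + U) % n   ≡⟨ involutive-ℕ 1<n ⟩
      1                           ∎
      where
      open ≡-Reasoning
      at-1 : ∀ V U → V * (V * 1 + U) + U ≡ V * V + suc V * U
      at-1 = solve-∀

    V-odd : ∃ λ w → V ≡ 1 + 2 * w
    -- `n` is even, so an even `V` would give `V * V` an even remainder, but that remainder is 1.
    V-odd = odd V λ 2∣V → 2∤1+2n 0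
      (subst (2 ∣_) V²%n≡1 (%-presˡ-∣ (∣m⇒∣m*n V 2∣V) (m∣m*n k)))

    w : ℕ
    w = proj₁ V-odd

    V≡ : V ≡ 1 + 2 * w
    V≡ = proj₂ V-odd

    k∣2w[1+w] : k ∣ 2 * (w * suc w)
    k∣2w[1+w] = *-cancelˡ-∣ 2 ([m+o]%n≡m%n⇒n∣o 1 (2 * (2 * (w * suc w))) n (begin
      (1 + 2 * (2 * (w * suc w))) % n     ≡⟨ cong (_% n) (square-odd w) ⟨
      ((1 + 2 * w) * (1 + 2 * w)) % n     ≡⟨ cong (λ V → (V * V) % n) V≡ ⟨
      (V * V) % n                         ≡⟨ V²%n≡1 ⟩
      1                                   ≡⟨ m<n⇒m%n≡m 1<n ⟨
      1 % n                               ∎))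
      where open ≡-Reasoning

    k∣[1+w]U : k ∣ suc w * U
    k∣[1+w]U = *-cancelˡ-∣ 2 (subst (n ∣_)
      (trans (cong (λ V → suc V * U) V≡) (double w U)) n∣[1+V]U)
      where
      double : ∀ w U → suc (1 + 2 * w) * U ≡ 2 * (suc w * U)
      double = solve-∀

    2gcd∤U : 2 * gcd w k ∤ U
    -- If `U ≡ q * (2 * gcd w k)`, some `x` has `k ∣ w * x + q * gcd w k`; doubling this makes `x` a
    -- fixed point.
    2gcd∤U (divides q U≡) = fixed-point-free (x mod n) (toℕ-injective (begin
      toℕ ((e^ u ∙ v) (x mod n))        ≡⟨ toℕ-affine u v (x mod n) ⟩
      (V * toℕ (x mod n) + U) % n       ≡⟨ cong (λ X → (V * X + U) % n) (toℕ-mod x) ⟩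
      (V * (x % n) + U) % n             ≡⟨ [m*[o%n]+p]%n≡[m*o+p]%n V x U n ⟩
      (V * x + U) % n                   ≡⟨ cong (λ V → (V * x + U) % n) V≡ ⟩
      ((1 + 2 * w) * x + U) % n         ≡⟨ cong (_% n) (affine-odd w x U) ⟩
      (x + (2 * (w * x) + U)) % n       ≡⟨ %-remove-+ʳ x n∣2wx+U ⟩
      x % n                             ≡⟨ toℕ-mod x ⟨
      toℕ (x mod n)                     ∎))
      where
      open ≡-Reasoning
      solution : ∃ λ x → k ∣ w * x + q * gcd w k
      solution = gcd∣⇒solvable w k (n∣m*n q)

      x : ℕ
      x = proj₁ solution

      double : ∀ y q g → 2 * (y + q * g) ≡ 2 * y + q * (2 * g)
      double = solve-∀

      n∣2wx+U : n ∣ 2 * (w * x) + U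
      n∣2wx+U = subst (n ∣_)
        (trans (double (w * x) q (gcd w k)) (cong (2 * (w * x) +_) (sym U≡)))
        (*-monoʳ-∣ 2 (proj₂ solution))

    parametrised : ∃ λ b → ∃ λ j → Param k U V b j
    parametrised = subst (λ V → ∃ λ b → ∃ λ j → Param k U V b j) (sym V≡)
      (decompose {w = w} k∣2w[1+w] k∣[1+w]U 2gcd∤U)

  module _ {u v : ℤ/ n} {b j : ℕ} (p : Param k (toℕ u) (toℕ v) b j) where
    open Param p

    private
      U V : ℕ
      U = toℕ u
      V = toℕ v

      k∣w[1+w] : k ∣ w * suc w
      k∣w[1+w] = subst (_∣ w * suc w) (sym k≡a*b) (*-pres-∣ a∣w b∣1+w)

      a∣U : a ∣ U
      a∣U = subst (a ∣_) (sym U≡) (m∣m*n (1 + 2 * j))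

      k∣[1+w]U : k ∣ suc w * U
      k∣[1+w]U = subst₂ _∣_ (sym k≡a*b) (ℕ.*-comm U (suc w)) (*-pres-∣ a∣U b∣1+w)

      n∣4w[1+w] : n ∣ 2 * (2 * (w * suc w))
      n∣4w[1+w] = *-monoʳ-∣ 2 (∣n⇒∣m*n 2 k∣w[1+w])

    -- `v` is its own inverse: by `square-odd` its square exceeds 1 by a multiple of `n`.
    param⇒unit : IsUnit v
    param⇒unit = v , v²≡1 , v²≡1
      where
      open ≡-Reasoning
      v²≡1 : (V * V) mod n ≡ 1 mod n
      v²≡1 = toℕ-injective (begin
        toℕ ((V * V) mod n)               ≡⟨ toℕ-mod (V * V) ⟩
        (V * V) % n                       ≡⟨ cong (λ V → (V * V) % n) V≡ ⟩
        ((1 + 2 * w) * (1 + 2 * w)) % n   ≡⟨ cong (_% n) (square-odd w) ⟩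
        (1 + 2 * (2 * (w * suc w))) % n   ≡⟨ %-remove-+ʳ 1 n∣4w[1+w] ⟩
        1 % n                             ≡⟨ toℕ-mod 1 ⟨
        toℕ (1 mod n)                     ∎)

    param⇒quasipolarity : IsQuasipolarity (u , v)
    param⇒quasipolarity = involutive , fixed-point-free
      where
      open ≡-Reasoning

      -- Applying the map twice moves `X` by two terms, which `n∣4w[1+w]` and `k∣[1+w]U` show to be
      -- multiples of `n`.
      expand : ∀ w U X → (1 + 2 * w) * ((1 + 2 * w) * X + U) + U ≡
               X + (2 * (2 * (w * suc w)) * X + 2 * (suc w * U))
      expand = solve-∀

      involutive : ∀ x → (e^ u ∙ v) ((e^ u ∙ v) x) ≡ x
      involutive x = toℕ-injective (begin
        toℕ ((e^ u ∙ v) ((e^ u ∙ v) x))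
          ≡⟨ toℕ-affine² u v x ⟩
        (V * (V * X + U) + U) % n
          ≡⟨ cong (λ V → (V * (V * X + U) + U) % n) V≡ ⟩
        ((1 + 2 * w) * ((1 + 2 * w) * X + U) + U) % n
          ≡⟨ cong (_% n) (expand w U X) ⟩
        (X + (2 * (2 * (w * suc w)) * X + 2 * (suc w * U))) % n
          ≡⟨ %-remove-+ʳ X (∣m∣n⇒∣m+n (∣m⇒∣m*n X n∣4w[1+w]) (*-monoʳ-∣ 2 k∣[1+w]U)) ⟩
        X % n
          ≡⟨ m<n⇒m%n≡m (toℕ<n x) ⟩
        X ∎)
        where
        X : ℕ
        X = toℕ x

      fixed-point-free : ∀ x → ¬ (e^ u ∙ v) x ≡ x
      -- A fixed point gives `2 * a ∣ a * (1 + 2 * j)`, and cancelling `a` makes 2 divide an odd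
      -- number.
      fixed-point-free x fixed = 2∤1+2n j (*-cancelˡ-∣ a {{a≢0}}
        (subst₂ _∣_ (ℕ.*-comm 2 a) U≡ 2a∣U))
        where
        X : ℕ
        X = toℕ x

        a≢0 : NonZero a
        a≢0 = ℕ.m*n≢0⇒m≢0 a {{subst NonZero k≡a*b (ℕ.≢-nonZero (ℕ.≢-nonZero⁻¹ k))}}

        n∣2wX+U : n ∣ 2 * (w * X) + U
        n∣2wX+U = [m+o]%n≡m%n⇒n∣o X (2 * (w * X) + U) n (begin
          (X + (2 * (w * X) + U)) % n   ≡⟨ cong (_% n) (affine-odd w X U) ⟨
          ((1 + 2 * w) * X + U) % n     ≡⟨ cong (λ V → (V * X + U) % n) V≡ ⟨
          (V * X + U) % n               ≡⟨ toℕ-affine u v x ⟨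
          toℕ ((e^ u ∙ v) x)            ≡⟨ cong toℕ fixed ⟩
          X                             ≡⟨ m<n⇒m%n≡m (toℕ<n x) ⟨
          X % n                         ∎)

        -- `2 * a` divides `n` and `2 * (w * X)`, hence the remaining summand `U`.
        2a∣U : 2 * a ∣ U
        2a∣U = ∣m+n∣m⇒∣n
          (∣-trans (*-monoʳ-∣ 2 (subst (a ∣_) (sym k≡a*b) (m∣m*n b))) n∣2wX+U)
          (*-monoʳ-∣ 2 (∣m⇒∣m*n X a∣w))

-- Enumeration of both sides and the count

quasipolarities : (n : ℕ) .{{_ : NonZero n}} → List (ℤ/ n × ℤ/ n)
quasipolarities n = filter isQuasipolarity? (affineElements n)

module _ {n : ℕ} .{{_ : NonZero n}} where

  quasipolarities-! : Unique (quasipolarities n)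
  quasipolarities-! = Unique.filter⁺ isQuasipolarity?
    (Unique.cartesianProduct⁺ (Unique.allFin⁺ n)
      (Unique.filter⁺ isUnit? (Unique.allFin⁺ n)))

  ∈-quasipolarities⁺ : ∀ {u v} → IsUnit v → IsQuasipolarity (u , v) →
                       (u , v) ∈ quasipolarities n
  ∈-quasipolarities⁺ {u} {v} unit quasi = ∈-filter⁺ isQuasipolarity?
    (∈-cartesianProduct⁺ (∈-allFin u) (∈-filter⁺ isUnit? (∈-allFin v) unit)) quasi

  ∈-quasipolarities⁻ : ∀ {g} → g ∈ quasipolarities n → IsQuasipolarity g
  ∈-quasipolarities⁻ {g} g∈ =
    proj₂ (∈-filter⁻ isQuasipolarity? {v = g} {xs = affineElements n} g∈)

unitaryDivisors : ℕ → List ℕ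
unitaryDivisors n = filter (_∥? n) (upTo (suc n))

unitaryDivisors-! : ∀ n → Unique (unitaryDivisors n)
unitaryDivisors-! n = Unique.filter⁺ (_∥? n) (Unique.upTo⁺ (suc n))

∈-unitaryDivisors⁺ : ∀ {d n} .{{_ : NonZero n}} → d ∥ n → d ∈ unitaryDivisors n
∈-unitaryDivisors⁺ {n = n} d∥n =
  ∈-filter⁺ (_∥? n) (∈-upTo⁺ (ℕ.s≤s (∣⇒≤ (_∥_.divides d∥n)))) d∥n

∈-unitaryDivisors⁻ : ∀ {d n} → d ∈ unitaryDivisors n → d ∥ n
∈-unitaryDivisors⁻ {n = n} d∈ = proj₂ (∈-filter⁻ (_∥? n) {xs = upTo (suc n)} d∈)

module _ (k : ℕ) .{{_ : NonZero k}} where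

  private
    instance
      2k≢0 : NonZero (2 * k)
      2k≢0 = m*n≢0 2 k

    pairs : List (ℕ × ℕ)
    pairs = below (unitaryDivisors k)

    -- The graph of the bijection. The record wrapper lets unification recover `g` and `y`, which
    -- `Param` sees only through projections and `toℕ`.
    record _↝_ (g : ℤ/ (2 * k) × ℤ/ (2 * k)) (y : ℕ × ℕ) : Set where
      constructor ⟨_⟩
      field
        parameters : Param k (toℕ (proj₁ g)) (toℕ (proj₂ g)) (proj₁ y) (proj₂ y)

    ↝-injective : ∀ {g g′ y} → g ↝ y → g′ ↝ y → g ≡ g′
    ↝-injective {u , v} {u′ , v′} ⟨ p ⟩ ⟨ p′ ⟩ =
      cong₂ _,_ (toℕ-injective (proj₁ U≡×V≡)) (toℕ-injective (proj₂ U≡×V≡))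
      where
      U≡×V≡ : toℕ u ≡ toℕ u′ × toℕ v ≡ toℕ v′
      U≡×V≡ = param-injective (toℕ<n v) (toℕ<n v′) p p′

    ↝-functional : ∀ {y y′ g} → g ↝ y → g ↝ y′ → y ≡ y′
    ↝-functional ⟨ p ⟩ ⟨ p′ ⟩ =
      cong₂ _,_ (proj₁ (param-functional p p′)) (proj₂ (param-functional p p′))

    -- The bound on `j` comes from `U` being a residue: `a * (1 + 2 * j) < 2 * (a * b)` forces
    -- `j < b`.
    ↝-∈pairs : ∀ {g y} → g ↝ y → y ∈ pairs
    ↝-∈pairs {u , _} {b , j} ⟨ p ⟩ =
      ∈-below⁺ (∈-unitaryDivisors⁺ (param-∥ p)) (U<2k⇒j<b {a = Param.a p} U<2ab)
      where
      U<2ab : Param.a p * (1 + 2 * j) < 2 * (Param.a p * b)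
      U<2ab = subst₂ (λ U k → U < 2 * k) (Param.U≡ p) (Param.k≡a*b p) (toℕ<n u)

    ↝-∈quasipolarities : ∀ {g y} → g ↝ y → g ∈ quasipolarities (2 * k)
    ↝-∈quasipolarities ⟨ p ⟩ = ∈-quasipolarities⁺ (param⇒unit p) (param⇒quasipolarity p)

    ↝-total : ∀ {g} → g ∈ quasipolarities (2 * k) → ∃ λ y → y ∈ pairs × g ↝ y
    ↝-total {g} g∈ = pack (quasipolarity⇒param {u = proj₁ g} {v = proj₂ g} (∈-quasipolarities⁻ {g = g} g∈))
      where
      pack : (∃ λ b → ∃ λ j → Param k (toℕ (proj₁ g)) (toℕ (proj₂ g)) b j) →
             ∃ λ y → y ∈ pairs × g ↝ y
      pack (b , j , p) = (b , j) , ↝-∈pairs ⟨ p ⟩ , ⟨ p ⟩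

    ↝-surjective : ∀ {y} → y ∈ pairs → ∃ λ g → g ∈ quasipolarities (2 * k) × g ↝ y
    ↝-surjective {b , j} y∈ = pack (param-exists (∈-unitaryDivisors⁻ b∈) j<b)
      where
      b∈ : b ∈ unitaryDivisors k
      b∈ = proj₁ (∈-below⁻ (unitaryDivisors k) y∈)

      j<b : j < b
      j<b = proj₂ (∈-below⁻ (unitaryDivisors k) y∈)

      pack : (∃ λ U → ∃ λ V → U < 2 * k × V < 2 * k × Param k U V b j) →
             ∃ λ g → g ∈ quasipolarities (2 * k) × g ↝ (b , j)
      pack (U , V , U<2k , V<2k , p) = g , ↝-∈quasipolarities g↝y , g↝y
        where
        g : ℤ/ (2 * k) × ℤ/ (2 * k)
        g = fromℕ< U<2k , fromℕ< V<2k

        g↝y : g ↝ (b , j)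
        g↝y = ⟨ subst₂ (λ U V → Param k U V b j)
          (sym (toℕ-fromℕ< U<2k)) (sym (toℕ-fromℕ< V<2k)) p ⟩

  -- `length-≤` is applied to `_↝_` and to its converse, one for each inequality; `length-below`
  -- then turns the number of pairs into the divisor sum.
  length-quasipolarities : length (quasipolarities (2 * k)) ≡ sum (unitaryDivisors k)
  length-quasipolarities = trans
    (ℕ.≤-antisym
      (length-≤ _↝_ quasipolarities-! ↝-total ↝-injective)
      (length-≤ (λ y g → g ↝ y) (below-! (unitaryDivisors-! k)) ↝-surjective ↝-functional))
    (length-below (unitaryDivisors k))

proposition2p3 : (k : ℕ) .{{_ : NonZero k}} → Q (2 *ℕ k) {{m*n≢0 2 k}} ≡ σ₁* k
proposition2p3 k = length-quasipolarities k
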